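{- Let $\Gamma$ and $\Sigma$ be two finite connected simple graphs with $m$ and $n$ vertices, respectively, having the same Euler characteristic, and suppose $m \leq n$. Then: (1) there is a finite sequence of moves, each of which is an expanding operation of type (i) or (ii) or an edge slide, which transforms $\Gamma$ into a graph isomorphic to $\Sigma$; (2) there is a finite sequence of moves, each of which is a collapsing operation of type (iii) or (iv) or an edge slide, which transforms $\Sigma$ into a graph isomorphic to $\Gamma$.
   Context: A simple graph has no loops and no double edges; write $x \sim y$ if the vertices $x,y$ are joined by an edge $\overline{xy}$, and $d(x)$ for the degree of $x$. The Euler characteristic of a finite graph is $\chi = (\text{number of vertices}) - (\text{number of edges})$. An (edge) slide on a graph $(V,E)$: given three distinct vertices $x,y,z \in V$ with $x \sim y \sim z$ and $x \not\sim z$, replace the edge $\overline{xy}$ by the edge $\overline{xz}$, so that the new graph is $(V, (E \setminus \{\overline{xy}\}) \cup \{\overline{xz}\})$. Expanding operations: (i) add a new vertex $y$ which is attached to any given vertex $x$ by a new edge $\overline{xy}$ (so that $d(y)=1$); (ii) for any edge $\overline{xz}$, add a new vertex $y$ to its interior, i.e. delete the edge $\overline{xz}$ and add the new vertex $y$ and the two edges $\overline{zy}$ and $\overline{yx}$. Collapsing operations: (iii) if $y$ is a vertex with $d(y)=1$, delete $y$ and the edge that joins it to the rest of the graph; (iv) if $y$ is a vertex with $d(y)=2$ whose two distinct neighbours $x$ and $z$ satisfy $x \not\sim z$, delete $y$ together with the edges $\overline{zy}$ and $\overline{yx}$ and add the edge $\overline{zx}$. Sequences of moves may be empty. -}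

module Defs where

open import Data.Fin using (Fin; _<_; punchIn)
open import Data.Fin.Properties using (_<?_)
open import Data.Integer using (ℤ; +_; _-_)
open import Data.List using (List; length; filter; allFin; cartesianProduct)
open import Data.Nat using (ℕ; suc; NonZero)
open import Data.Product using (Σ; ∃; _×_; _,_; proj₁; proj₂)
open import Data.Sum using (_⊎_)
open import Function.Bundles using (_⇔_; _↔_; Inverse)
open import Level using (0ℓ) renaming (suc to lsuc)
open import Relation.Binary using (Rel; Decidable; Symmetric; Irreflexive)
open import Relation.Binary.Construct.Closure.ReflexiveTransitive using (Star)
open import Relation.Binary.PropositionalEquality using (_≡_; _≢_)
open import Relation.Nullary using (¬_)
open import Relation.Nullary.Decidable using (_×-dec_)

record SimpleGraph (n : ℕ) : Set₁ where
  infix 4 _∼_ _∼?_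
  field
    _∼_    : Rel (Fin n) 0ℓ
    _∼?_   : Decidable _∼_
    sym    : Symmetric _∼_
    irrefl : Irreflexive _≡_ _∼_

  degree : Fin n → ℕ
  degree x = length (filter (x ∼?_) (allFin n))

  -- Each edge is listed once, as the pair (u , v) of its ends with u < v.
  edges : List (Fin n × Fin n)
  edges = filter (λ e → (proj₁ e <? proj₂ e) ×-dec (proj₁ e ∼? proj₂ e))
                 (cartesianProduct (allFin n) (allFin n))

  χ : ℤ
  χ = + n - + length edges

open SimpleGraph using (χ; degree)

-- The empty graph is not connected.
record Connected {n : ℕ} (G : SimpleGraph n) : Set where
  open SimpleGraph G using (_∼_)
  field
    nonEmpty : NonZero n
    path     : ∀ u v → Star _∼_ u v

record _≅_ {m n : ℕ} (G : SimpleGraph m) (H : SimpleGraph n) : Set where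
  private
    module G = SimpleGraph G
    module H = SimpleGraph H
  field
    bijection : Fin m ↔ Fin n
  open Inverse bijection using (to)
  field
    adjacency : ∀ u v → (u G.∼ v) ⇔ (to u H.∼ to v)

infix 4 _≅_

-- The unordered pairs {u , v} and {x , y} are equal.
SameEdge : ∀ {n} → (u v x y : Fin n) → Set
SameEdge u v x y = (u ≡ x × v ≡ y) ⊎ (u ≡ y × v ≡ x)

-- A move is a relation between the graph before and the graph after it; the
-- latter is pinned down by its adjacency relation.  When the vertex sets differ
-- by a vertex y : Fin (suc n), the vertices other than y are the values of
-- punchIn y : Fin n → Fin (suc n).

record Slide {n : ℕ} (G H : SimpleGraph n) : Set where
  private
    module G = SimpleGraph G
    module H = SimpleGraph H
  field
    x y z  : Fin n
    x≢y    : x ≢ y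
    y≢z    : y ≢ z
    x≢z    : x ≢ z
    x∼y    : x G.∼ y
    y∼z    : y G.∼ z
    x≁z    : ¬ (x G.∼ z)
    result : ∀ u v → (u H.∼ v) ⇔
               (((u G.∼ v) × ¬ SameEdge u v x y) ⊎ SameEdge u v x z)

-- A new vertex y joined to x only; H is irreflexive and symmetric, so the
-- two fields old and new determine its adjacency relation.
record AddLeaf {n : ℕ} (G : SimpleGraph n) (H : SimpleGraph (suc n)) : Set where
  private
    module G = SimpleGraph G
    module H = SimpleGraph H
  field
    x     : Fin n
    y     : Fin (suc n)
    old   : ∀ u v → (punchIn y u H.∼ punchIn y v) ⇔ (u G.∼ v)
    new   : ∀ u → (punchIn y u H.∼ y) ⇔ (u ≡ x)

-- A new vertex y in the interior of the edge xz.
record Subdivide {n : ℕ} (G : SimpleGraph n) (H : SimpleGraph (suc n)) : Set where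
  private
    module G = SimpleGraph G
    module H = SimpleGraph H
  field
    x z   : Fin n
    x∼z   : x G.∼ z
    y     : Fin (suc n)
    old   : ∀ u v → (punchIn y u H.∼ punchIn y v) ⇔
              ((u G.∼ v) × ¬ SameEdge u v x z)
    new   : ∀ u → (punchIn y u H.∼ y) ⇔ (u ≡ x ⊎ u ≡ z)

record DeleteLeaf {n : ℕ} (G : SimpleGraph (suc n)) (H : SimpleGraph n) : Set where
  private
    module G = SimpleGraph G
    module H = SimpleGraph H
  field
    y      : Fin (suc n)
    deg-y  : degree G y ≡ 1
    result : ∀ u v → (u H.∼ v) ⇔ (punchIn y u G.∼ punchIn y v)

-- Suppression of a vertex y of degree 2 with non-adjacent
-- neighbours x and z.
record Suppress {n : ℕ} (G : SimpleGraph (suc n)) (H : SimpleGraph n) : Set where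
  private
    module G = SimpleGraph G
    module H = SimpleGraph H
  field
    x y z  : Fin (suc n)
    deg-y  : degree G y ≡ 2
    y∼x    : y G.∼ x
    y∼z    : y G.∼ z
    x≢z    : x ≢ z
    x≁z    : ¬ (x G.∼ z)
    result : ∀ u v → (u H.∼ v) ⇔
               ((punchIn y u G.∼ punchIn y v) ⊎
                SameEdge (punchIn y u) (punchIn y v) x z)

FiniteGraph : Set₁
FiniteGraph = Σ ℕ SimpleGraph

data ExpandOrSlide : Rel FiniteGraph (lsuc 0ℓ) where
  addLeaf   : ∀ {n} {G : SimpleGraph n} {H} → AddLeaf G H →
              ExpandOrSlide (n , G) (suc n , H)
  subdivide : ∀ {n} {G : SimpleGraph n} {H} → Subdivide G H →
              ExpandOrSlide (n , G) (suc n , H)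
  slide     : ∀ {n} {G H : SimpleGraph n} → Slide G H →
              ExpandOrSlide (n , G) (n , H)

data CollapseOrSlide : Rel FiniteGraph (lsuc 0ℓ) where
  deleteLeaf : ∀ {n} {G : SimpleGraph (suc n)} {H} → DeleteLeaf G H →
               CollapseOrSlide (suc n , G) (n , H)
  suppress   : ∀ {n} {G : SimpleGraph (suc n)} {H} → Suppress G H →
               CollapseOrSlide (suc n , G) (n , H)
  slide      : ∀ {n} {G H : SimpleGraph n} → Slide G H →
               CollapseOrSlide (n , G) (n , H)

-- Some finite, possibly empty, sequence of R-moves turns G into a graph
-- isomorphic to H.
TransformsInto : ∀ {m n} → Rel FiniteGraph (lsuc 0ℓ) →
                 SimpleGraph m → SimpleGraph n → Set₁
TransformsInto {m} R G H =
  ∃ λ (K : FiniteGraph) → Star R (m , G) K × (proj₂ K ≅ H)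

{-# OPTIONS --safe #-}
-- Slides are reversible, so it suffices to grow Γ by leaves to the size of Σ
-- and to connect two connected graphs on the same labelled vertex set having
-- equally many edges.  A connected graph in which the vertex 0 is not joined to
-- every other vertex contains x ∼ y ∼ 0 with x ≁ 0, and sliding xy to x0 enlarges
-- the neighbourhood of 0; hence we may assume that 0 is a hub of both graphs.
-- In a graph with hub 0, an edge xy can be replaced by a non-edge xz in two
-- slides, x0 to xz (through 0 ∼ z) and then xy to x0 (through y ∼ 0).  Such
-- replacements move any edge to any non-edge, so the edges of one graph missing
-- from the other can be supplied one at a time.
module Submission where

open import Defs
open import Algebra.Bundles using (AbelianGroup)
open import Algebra.Properties.Group using (∙-cancelˡ)
open import Data.Empty using (⊥)
open import Data.Fin using (Fin; zero; suc; _<_)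
open import Data.Fin.Properties using (_≟_; _<?_; <-cmp; <-asym)
import Data.Integer as ℤ
import Data.Integer.Properties as ℤ
open import Data.List using (List; []; _∷_; length; filter; map; allFin; cartesianProduct)
open import Data.List.Membership.Propositional using (_∈_; _∉_; find)
open import Data.List.Membership.Propositional.Properties
  using (∈-filter⁺; ∈-filter⁻; ∈-allFin; ∈-cartesianProduct⁺; ∈-map⁺; ∈-map⁻)
open import Data.List.Membership.Propositional.Properties.WithK using (unique∧set⇒bag)
open import Data.List.Properties using (filter-notAll; length-map)
open import Data.List.Relation.Binary.BagAndSetEquality using (∼bag⇒↭)
open import Data.List.Relation.Binary.Permutation.Propositional.Properties using (↭-length)
open import Data.List.Relation.Unary.All as All using ([])
import Data.List.Relation.Unary.All.Properties as All
open import Data.List.Relation.Unary.AllPairs using ([]; _∷_)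
open import Data.List.Relation.Unary.Any as Any using (here; there)
open import Data.List.Relation.Unary.Unique.Propositional using (Unique)
import Data.List.Relation.Unary.Unique.Propositional.Properties as Unique
open import Data.Nat using (ℕ; zero; suc; _≤_; _≤′_; ≤′-refl; ≤′-step; z<s; s<s; NonZero)
import Data.Nat.Properties as ℕ
open import Data.Product using (∃; ∃₂; _×_; _,_; proj₁; proj₂)
import Data.Product as Product
open import Data.Product.Properties using (≡-dec)
open import Data.Sum using (_⊎_; inj₁; inj₂; swap)
open import Function using (_∘_; id; _⇔_; mk⇔; Equivalence; case_of_)
open import Function.Construct.Identity using (↔-id; ⇔-id)
open import Function.Construct.Composition using (_⇔-∘_)
open import Function.Construct.Symmetry using (⇔-sym)
open import Level using (0ℓ) renaming (suc to lsuc)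
open import Relation.Binary using (Rel; Symmetric; tri<; tri≈; tri>)
open import Relation.Binary.Construct.Closure.ReflexiveTransitive
  using (Star; ε; _◅_; _◅◅_; gmap; kleisliStar; reverse; return)
open import Relation.Binary.PropositionalEquality
  using (_≡_; _≢_; refl; sym; trans; cong; subst; ≢-sym; module ≡-Reasoning)
open import Relation.Nullary using (¬_; Dec; yes; no; contradiction)
open import Relation.Nullary.Decidable using (_×-dec_; _⊎-dec_; ¬?; decidable-stable)

open Equivalence using (to; from)
open SimpleGraph using (χ; edges)

private
  variable
    n : ℕ
    a b c d p q u v : Fin n
    G H K T : SimpleGraph n

-- Counting with duplicate-free lists

unique-length : ∀ {A : Set} {xs ys : List A} → Unique xs → Unique ys →
                (∀ {e} → e ∈ xs ⇔ e ∈ ys) → length xs ≡ length ys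
unique-length xs! ys! eq = ↭-length (∼bag⇒↭ (unique∧set⇒bag xs! ys! eq))

∉⇒unique-∷ : ∀ {A : Set} {x : A} {xs} → x ∉ xs → Unique xs → Unique (x ∷ xs)
∉⇒unique-∷ x∉xs xs! = All.¬Any⇒All¬ _ x∉xs ∷ xs!

_≟ₑ_ : (e f : Fin n × Fin n) → Dec (e ≡ f)
_≟ₑ_ = ≡-dec _≟_ _≟_

-- If xs were contained in ys, it would be as long as the proper sublist of ys
-- consisting of its own members.
pigeonhole : ∀ {xs ys : List (Fin n × Fin n)} → Unique xs → Unique ys →
             length xs ≡ length ys → (∃ λ e → e ∈ ys × e ∉ xs) →
             ∃ λ f → f ∈ xs × f ∉ ys
pigeonhole {xs = xs} {ys} xs! ys! eq (e , e∈ys , e∉xs)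
  with All.all? (λ f → Any.any? (f ≟ₑ_) ys) xs
... | no ¬xs⊆ys = find (All.¬All⇒Any¬ (λ f → Any.any? (f ≟ₑ_) ys) xs ¬xs⊆ys)
... | yes xs⊆ys = contradiction (trans (sym |common|) eq)
                    (ℕ.<⇒≢ (filter-notAll ∈xs? ys (Any.map (λ { refl → e∉xs }) e∈ys)))
  where
  ∈xs? = λ f → Any.any? (f ≟ₑ_) xs
  |common| : length xs ≡ length (filter ∈xs? ys)
  |common| = unique-length xs! (Unique.filter⁺ ∈xs? ys!)
    (mk⇔ (λ f∈xs → ∈-filter⁺ ∈xs? (All.lookup xs⊆ys f∈xs) f∈xs)
         (λ f∈ → proj₂ (∈-filter⁻ ∈xs? {xs = ys} f∈)))

-- Unordered pairs

sameEdge? : (u v x y : Fin n) → Dec (SameEdge u v x y)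
sameEdge? u v x y = ((u ≟ x) ×-dec (v ≟ y)) ⊎-dec ((u ≟ y) ×-dec (v ≟ x))

sameEdge-refl : SameEdge u v u v
sameEdge-refl = inj₁ (refl , refl)

sameEdge-swapˡ : SameEdge u v a b → SameEdge v u a b
sameEdge-swapˡ (inj₁ (p , q)) = inj₂ (q , p)
sameEdge-swapˡ (inj₂ (p , q)) = inj₁ (q , p)

sameEdge-join : SameEdge u v a b → SameEdge u v c d → SameEdge a b c d
sameEdge-join (inj₁ (refl , refl)) s = s
sameEdge-join (inj₂ (refl , refl)) s = sameEdge-swapˡ s

sameEdge-sym : SameEdge u v a b → SameEdge a b u v
sameEdge-sym s = sameEdge-join s sameEdge-refl

-- `edges` lists increasing pairs only, so an edge given as an unordered pair has to be put in order
-- before it can be counted.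
orient : a ≢ b → ∃₂ λ p q → p < q × SameEdge p q a b
orient {a = a} {b} a≢b with <-cmp a b
... | tri< a<b _ _ = a , b , a<b , inj₁ (refl , refl)
... | tri≈ _ a≡b _ = contradiction a≡b a≢b
... | tri> _ _ b<a = b , a , b<a , inj₂ (refl , refl)

-- Two listings of one unordered pair agree up to a swap, and a swap would reverse the order.
sameEdge-ordered : ∀ {n} {u v p q a b : Fin n} → u < v → p < q →
                   SameEdge u v a b → SameEdge p q a b → (u , v) ≡ (p , q)
sameEdge-ordered u<v p<q s t with sameEdge-join (sameEdge-sym s) (sameEdge-sym t)
... | inj₁ (refl , refl) = refl
... | inj₂ (refl , refl) = contradiction p<q (<-asym u<v)

-- Adjacency

module _ (G : SimpleGraph n) where
  open SimpleGraph G hiding (edges)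

  ∼⇒≢ : u ∼ v → u ≢ v
  ∼⇒≢ u∼v u≡v = irrefl u≡v u∼v

  ∼-resp : SameEdge u v a b → a ∼ b → u ∼ v
  ∼-resp (inj₁ (refl , refl)) = id
  ∼-resp (inj₂ (refl , refl)) = SimpleGraph.sym G

  ∈-edges⁺ : u < v → u ∼ v → (u , v) ∈ edges G
  ∈-edges⁺ u<v u∼v = ∈-filter⁺ (λ e → (proj₁ e <? proj₂ e) ×-dec (proj₁ e ∼? proj₂ e))
    (∈-cartesianProduct⁺ (∈-allFin _) (∈-allFin _)) (u<v , u∼v)

  ∈-edges⁻ : (u , v) ∈ edges G → u < v × u ∼ v
  ∈-edges⁻ e∈ = proj₂ (∈-filter⁻ (λ e → (proj₁ e <? proj₂ e) ×-dec (proj₁ e ∼? proj₂ e))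
    {xs = cartesianProduct (allFin n) (allFin n)} e∈)

  edges-unique : Unique (edges G)
  edges-unique = Unique.filter⁺ _ (Unique.cartesianProduct⁺ (Unique.allFin⁺ n) (Unique.allFin⁺ n))

module _ (T G : SimpleGraph n) where
  private
    module T = SimpleGraph T
    module G = SimpleGraph G

  missing? : (e : Fin n × Fin n) → Dec (¬ (proj₁ e G.∼ proj₂ e))
  missing? e = ¬? (proj₁ e G.∼? proj₂ e)

  -- The length of this list is the measure of two inductions: with the star for `T` it counts the
  -- vertices not yet joined to `zero`, and with the target graph for `T` it counts the edges still
  -- to be supplied.
  missing : List (Fin n × Fin n)
  missing = filter missing? (edges T)

  missing-unique : Unique missing
  missing-unique = Unique.filter⁺ missing? (edges-unique T)

  ∈-missing⁺ : u < v → u T.∼ v → ¬ (u G.∼ v) → (u , v) ∈ missing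
  ∈-missing⁺ u<v u∼v u≁v = ∈-filter⁺ missing? (∈-edges⁺ T u<v u∼v) u≁v

  ∈-missing⁻ : (u , v) ∈ missing → u < v × u T.∼ v × ¬ (u G.∼ v)
  ∈-missing⁻ e∈ with ∈-filter⁻ missing? {xs = edges T} e∈
  ... | e∈T , u≁v with ∈-edges⁻ T e∈T
  ...   | u<v , u∼v = u<v , u∼v , u≁v

  missing-∃ : u T.∼ v → ¬ (u G.∼ v) → ∃ (_∈ missing)
  missing-∃ u∼v u≁v with orient (∼⇒≢ T u∼v)
  ... | p , q , p<q , s = (p , q) , ∈-missing⁺ p<q (∼-resp T s u∼v)
    (u≁v ∘ ∼-resp G (sameEdge-sym s))

  none-missing : length missing ≡ 0 → u T.∼ v → u G.∼ v
  none-missing {u} {v} none u∼v = decidable-stable (u G.∼? v) λ u≁v →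
    empty missing none (proj₂ (missing-∃ u∼v u≁v))
    where
    empty : ∀ {e} (es : List (Fin n × Fin n)) → length es ≡ 0 → e ∉ es
    empty [] _ ()

  some-missing : ∀ {k} → length missing ≡ suc k →
                 ∃₂ λ u v → u T.∼ v × ¬ (u G.∼ v)
  some-missing some with missing in eq
  ... | (u , v) ∷ _ = u , v , proj₂ (∈-missing⁻ (subst ((u , v) ∈_) (sym eq) (here refl)))

-- By `pigeonhole`, equally long edge lists cannot differ in one direction only. The edge found is
-- the one that can be given up in exchange for the missing one.
surplus-∃ : length (edges T) ≡ length (edges G) →
            let open SimpleGraph in
            _∼_ T u v → ¬ _∼_ G u v → ∃₂ λ p q → _∼_ G p q × ¬ _∼_ T p q
surplus-∃ {T = T} {G} eq u∼v u≁v
  with missing-∃ T G u∼v u≁v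
... | e , e∈ with ∈-missing⁻ T G e∈
... | p<q , p∼q , p≁q
  with pigeonhole (edges-unique G) (edges-unique T) (sym eq)
         (e , ∈-edges⁺ T p<q p∼q , p≁q ∘ proj₂ ∘ ∈-edges⁻ G)
... | f , f∈G , f∉T with ∈-edges⁻ G f∈G
... | r<s , r∼s = proj₁ f , proj₂ f , r∼s , f∉T ∘ ∈-edges⁺ T r<s

-- Replacing edges

infix 4 _≈_

-- A move determines its result only up to logically equivalent adjacency, so this relation takes
-- the place of equality of graphs on the same labelled vertices.
record _≈_ (G H : SimpleGraph n) : Set where
  constructor mk≈
  private
    module G = SimpleGraph G
    module H = SimpleGraph H
  field
    adj : ∀ u v → (u G.∼ v) ⇔ (u H.∼ v)

open _≈_

≈-refl : G ≈ G
≈-refl .adj _ _ = ⇔-id _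

≈-sym : G ≈ H → H ≈ G
≈-sym e .adj u v = ⇔-sym (e .adj u v)

≈-trans : G ≈ H → H ≈ K → G ≈ K
≈-trans e f .adj u v = f .adj u v ⇔-∘ e .adj u v

≈⇒≅ : G ≈ H → G ≅ H
≈⇒≅ e = record { bijection = ↔-id _ ; adjacency = e .adj }

≈-edges : G ≈ H → length (edges G) ≡ length (edges H)
≈-edges {G = G} {H} e = unique-length (edges-unique G) (edges-unique H)
  (mk⇔ (λ i → let u<v , u∼v = ∈-edges⁻ G i in ∈-edges⁺ H u<v (e .adj _ _ .to u∼v))
       (λ i → let u<v , u∼v = ∈-edges⁻ H i in ∈-edges⁺ G u<v (e .adj _ _ .from u∼v)))

-- The `result` clause of a slide, freed from its side conditions: the two pairs need not share a
-- vertex. Single slides and their longer composites are thus handled by the same lemmas.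
record Replaced (G H : SimpleGraph n) (a b c d : Fin n) : Set where
  constructor mkReplaced
  private
    module G = SimpleGraph G
    module H = SimpleGraph H
  field
    rule : ∀ u v → (u H.∼ v) ⇔ (((u G.∼ v) × ¬ SameEdge u v a b) ⊎ SameEdge u v c d)

open Replaced

replace : SimpleGraph n → (a b c d : Fin n) → c ≢ d → SimpleGraph n
replace G a b c d c≢d = record
  { _∼_    = λ u v → ((u ∼ v) × ¬ SameEdge u v a b) ⊎ SameEdge u v c d
  ; _∼?_   = λ u v → ((u ∼? v) ×-dec ¬? (sameEdge? u v a b)) ⊎-dec sameEdge? u v c d
  ; sym    = λ { (inj₁ (u∼v , ≢ab)) → inj₁ (SimpleGraph.sym G u∼v , ≢ab ∘ sameEdge-swapˡ)
               ; (inj₂ ≡cd) → inj₂ (sameEdge-swapˡ ≡cd) }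
  ; irrefl = λ { refl (inj₁ (u∼u , _)) → irrefl refl u∼u
               ; refl (inj₂ (inj₁ (refl , u≡d))) → c≢d u≡d
               ; refl (inj₂ (inj₂ (refl , u≡c))) → c≢d (sym u≡c) }
  }
  where open SimpleGraph G hiding (sym)

replace-replaced : (c≢d : c ≢ d) → Replaced G (replace G a b c d c≢d) a b c d
replace-replaced _ .rule _ _ = ⇔-id _

module _ {n} {G H : SimpleGraph n} {a b c d} (r : Replaced G H a b c d) where
  private
    module G = SimpleGraph G
    module H = SimpleGraph H

  kept : u G.∼ v → ¬ SameEdge u v a b → u H.∼ v
  kept u∼v ≢ab = r .rule _ _ .from (inj₁ (u∼v , ≢ab))

  added : c H.∼ d
  added = r .rule _ _ .from (inj₂ sameEdge-refl)

  origin : u H.∼ v → ¬ SameEdge u v c d → u G.∼ v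
  origin u∼v ≢cd with r .rule _ _ .to u∼v
  ... | inj₁ (u∼v′ , _) = u∼v′
  ... | inj₂ ≡cd        = contradiction ≡cd ≢cd

  removed : ¬ SameEdge a b c d → ¬ (a H.∼ b)
  removed ab≢cd a∼b with r .rule _ _ .to a∼b
  ... | inj₁ (_ , ≢ab) = ≢ab sameEdge-refl
  ... | inj₂ ≡cd       = ab≢cd ≡cd

  replaced-swapˡ : Replaced G H b a c d
  replaced-swapˡ .rule u v = mk⇔
    (λ h → case r .rule u v .to h of λ
      { (inj₁ (g , ≢ab)) → inj₁ (g , ≢ab ∘ swap) ; (inj₂ s) → inj₂ s })
    (λ { (inj₁ (g , ≢ba)) → r .rule u v .from (inj₁ (g , ≢ba ∘ swap))
       ; (inj₂ s) → r .rule u v .from (inj₂ s) })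

  replaced-swapʳ : Replaced G H a b d c
  replaced-swapʳ .rule u v = mk⇔
    (λ h → case r .rule u v .to h of λ
      { (inj₁ g) → inj₁ g ; (inj₂ s) → inj₂ (swap s) })
    (λ { (inj₁ g) → r .rule u v .from (inj₁ g)
       ; (inj₂ s) → r .rule u v .from (inj₂ (swap s)) })

  -- Going back restores `ab` and deletes `cd`; this recovers `G` because `ab` was present in it and
  -- `cd` absent.
  replaced-reverse : a G.∼ b → ¬ (c G.∼ d) → Replaced H G c d a b
  replaced-reverse a∼b c≁d .rule u v = mk⇔ forth back
    where
    forth : u G.∼ v → ((u H.∼ v) × ¬ SameEdge u v c d) ⊎ SameEdge u v a b
    forth u∼v with sameEdge? u v a b
    ... | yes ≡ab = inj₂ ≡ab
    ... | no  ≢ab = inj₁ (kept u∼v ≢ab ,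
                          λ ≡cd → c≁d (∼-resp G (sameEdge-sym ≡cd) u∼v))
    back : ((u H.∼ v) × ¬ SameEdge u v c d) ⊎ SameEdge u v a b → u G.∼ v
    back (inj₁ (h , ≢cd)) = origin h ≢cd
    back (inj₂ ≡ab)       = ∼-resp G ≡ab a∼b

  -- Adding `cd` to `G` and adding `ab` to `H` give the same set of edges. Each addition is of a new
  -- edge, so the two counts agree after adding one to both.
  replaced-edges : a G.∼ b → ¬ (c G.∼ d) → length (edges G) ≡ length (edges H)
  replaced-edges a∼b c≁d
    with orient (∼⇒≢ G a∼b) | orient (∼⇒≢ H added)
  ... | p , q , p<q , pq≡ab | s , t , s<t , st≡cd = ℕ.suc-injective
    (unique-length {xs = (s , t) ∷ edges G} {ys = (p , q) ∷ edges H}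
      (∉⇒unique-∷ (st≁ ∘ proj₂ ∘ ∈-edges⁻ G) (edges-unique G))
      (∉⇒unique-∷ (pq≁ ∘ proj₂ ∘ ∈-edges⁻ H) (edges-unique H))
      (mk⇔ forth back))
    where
    st≁ : ¬ (s G.∼ t)
    st≁ = c≁d ∘ ∼-resp G (sameEdge-sym st≡cd)
    pq∼ : p G.∼ q
    pq∼ = ∼-resp G pq≡ab a∼b
    pq≢cd : ¬ SameEdge p q c d
    pq≢cd ≡cd = c≁d (∼-resp G (sameEdge-sym ≡cd) pq∼)
    pq≁ : ¬ (p H.∼ q)
    pq≁ h with r .rule _ _ .to h
    ... | inj₁ (_ , ≢ab) = ≢ab pq≡ab
    ... | inj₂ ≡cd       = pq≢cd ≡cd
    forth : ∀ {e} → e ∈ (s , t) ∷ edges G → e ∈ (p , q) ∷ edges H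
    forth (here refl) = there (∈-edges⁺ H s<t (∼-resp H st≡cd added))
    forth {u , v} (there e∈) with ∈-edges⁻ G e∈ | sameEdge? u v a b
    ... | u<v , u∼v | yes ≡ab = here (sameEdge-ordered u<v p<q ≡ab pq≡ab)
    ... | u<v , u∼v | no  ≢ab = there (∈-edges⁺ H u<v (kept u∼v ≢ab))
    back : ∀ {e} → e ∈ (p , q) ∷ edges H → e ∈ (s , t) ∷ edges G
    back (here refl) = there (∈-edges⁺ G p<q pq∼)
    back {u , v} (there e∈) with ∈-edges⁻ H e∈ | sameEdge? u v c d
    ... | u<v , u∼v | yes ≡cd = here (sameEdge-ordered u<v s<t ≡cd st≡cd)
    ... | u<v , u∼v | no  ≢cd = there (∈-edges⁺ G u<v (origin u∼v ≢cd))

  module _ (T : SimpleGraph n) where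
    private module T = SimpleGraph T

    -- Losing `ab` costs nothing, as `T` does not contain it, while `cd` is an edge of `T` that `G`
    -- lacked.
    replaced-missing : ¬ (a T.∼ b) → c T.∼ d → ¬ (c G.∼ d) →
                       length (missing T G) ≡ suc (length (missing T H))
    replaced-missing a≁b c∼d c≁d with orient (∼⇒≢ H added)
    ... | s , t , s<t , st≡cd =
      unique-length {ys = (s , t) ∷ missing T H} (missing-unique T G)
        (∉⇒unique-∷ (λ i → proj₂ (proj₂ (∈-missing⁻ T H i)) (∼-resp H st≡cd added))
                    (missing-unique T H))
        (mk⇔ forth back)
      where
      forth : ∀ {e} → e ∈ missing T G → e ∈ (s , t) ∷ missing T H
      forth {u , v} e∈ with ∈-missing⁻ T G e∈ | sameEdge? u v c d
      ... | u<v , _   , _   | yes ≡cd = here (sameEdge-ordered u<v s<t ≡cd st≡cd)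
      ... | u<v , u∼v , u≁v | no  ≢cd =
        there (∈-missing⁺ T H u<v u∼v (λ h → u≁v (origin h ≢cd)))
      back : ∀ {e} → e ∈ (s , t) ∷ missing T H → e ∈ missing T G
      back (here refl) = ∈-missing⁺ T G s<t (∼-resp T st≡cd c∼d)
        (c≁d ∘ ∼-resp G (sameEdge-sym st≡cd))
      back (there e∈) with ∈-missing⁻ T H e∈
      ... | u<v , u∼v , u≁v = ∈-missing⁺ T G u<v u∼v λ g →
        u≁v (kept g (λ ≡ab → a≁b (∼-resp T (sameEdge-sym ≡ab) u∼v)))

module _ {n} {G G₁ H : SimpleGraph n} {a b c d p q : Fin n} where
  private
    module G  = SimpleGraph G
    module G₁ = SimpleGraph G₁
    module H  = SimpleGraph H

  -- pq → cd is the composite of ab → cd and pq → ab.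
  replaced-exchange : Replaced G G₁ a b c d → Replaced G H p q c d → a G.∼ b →
                      ¬ SameEdge a b p q → ¬ SameEdge c d p q → Replaced G₁ H p q a b
  replaced-exchange r₁ r a∼b ab≢pq cd≢pq .rule u v = mk⇔ forth back
    where
    forth : u H.∼ v → ((u G₁.∼ v) × ¬ SameEdge u v p q) ⊎ SameEdge u v a b
    forth h with r .rule u v .to h | sameEdge? u v a b
    ... | _              | yes ≡ab = inj₂ ≡ab
    ... | inj₁ (g , ≢pq) | no  ≢ab = inj₁ (kept r₁ g ≢ab , ≢pq)
    ... | inj₂ ≡cd       | no  _   = inj₁ (∼-resp G₁ ≡cd (added r₁) , cd≢pq ∘ sameEdge-join ≡cd)
    back : ((u G₁.∼ v) × ¬ SameEdge u v p q) ⊎ SameEdge u v a b → u H.∼ v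
    back (inj₂ ≡ab) = kept r (∼-resp G ≡ab a∼b) (ab≢pq ∘ sameEdge-join ≡ab)
    back (inj₁ (g₁ , ≢pq)) with r₁ .rule u v .to g₁
    ... | inj₁ (g , _) = kept r g ≢pq
    ... | inj₂ ≡cd     = ∼-resp H ≡cd (added r)

  -- ab → cd is the composite of ab → pq and pq → cd.
  replaced-compose : Replaced G G₁ a b p q → Replaced G H a b c d → ¬ (p G.∼ q) →
                     Replaced G₁ H p q c d
  replaced-compose r₁ r p≁q .rule u v = mk⇔ forth back
    where
    forth : u H.∼ v → ((u G₁.∼ v) × ¬ SameEdge u v p q) ⊎ SameEdge u v c d
    forth h with r .rule u v .to h
    ... | inj₁ (g , ≢ab) = inj₁ (kept r₁ g ≢ab ,
                                 λ ≡pq → p≁q (∼-resp G (sameEdge-sym ≡pq) g))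
    ... | inj₂ ≡cd       = inj₂ ≡cd
    back : ((u G₁.∼ v) × ¬ SameEdge u v p q) ⊎ SameEdge u v c d → u H.∼ v
    back (inj₂ ≡cd) = ∼-resp H ≡cd (added r)
    back (inj₁ (g₁ , ≢pq)) with r₁ .rule u v .to g₁
    ... | inj₁ (g , ≢ab) = kept r g ≢ab
    ... | inj₂ ≡pq       = contradiction ≡pq ≢pq

-- Slides

slide-replaced : (s : Slide G H) → let open Slide s in Replaced G H x y x z
slide-replaced s = mkReplaced (Slide.result s)

-- The edge `yz` is untouched by the slide, so `xz` can slide back to `xy` along it, with `y` and
-- `z` exchanging roles.
slide-sym : Slide G H → Slide H G
slide-sym {G = G} {H} s = record
  { x = x ; y = z ; z = y
  ; x≢y = x≢z ; y≢z = ≢-sym y≢z ; x≢z = x≢y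
  ; x∼y = added r
  ; y∼z = SimpleGraph.sym H (kept r y∼z λ
      { (inj₁ (y≡x , _)) → x≢y (sym y≡x) ; (inj₂ (_ , z≡x)) → x≢z (sym z≡x) })
  ; x≁z = removed r (λ { (inj₁ (_ , y≡z)) → y≢z y≡z ; (inj₂ (x≡z , _)) → x≢z x≡z })
  ; result = replaced-reverse r x∼y x≁z .rule
  }
  where
  open Slide s
  r = slide-replaced s

slide-≈ : G ≈ H → Slide H K → Slide G K
slide-≈ e s = record
  { x≢y = x≢y ; y≢z = y≢z ; x≢z = x≢z
  ; x∼y = e .adj _ _ .from x∼y
  ; y∼z = e .adj _ _ .from y∼z
  ; x≁z = x≁z ∘ e .adj _ _ .to
  ; result = λ u v → mk⇔
      (λ k → case result u v .to k of λ
        { (inj₁ (h , ≢xy)) → inj₁ (e .adj u v .from h , ≢xy) ; (inj₂ ≡xz) → inj₂ ≡xz })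
      (λ { (inj₁ (g , ≢xy)) → result u v .from (inj₁ (e .adj u v .to g , ≢xy))
         ; (inj₂ ≡xz) → result u v .from (inj₂ ≡xz) })
  }
  where open Slide s

-- The lost edge `xy` is bypassed by the path from `x` through `z` to `y`.
slide-connected : Slide G H → Connected G → Connected H
slide-connected {G = G} {H} s conn = record
  { nonEmpty = nonEmpty
  ; path = λ u v → kleisliStar id reroute (path u v)
  }
  where
  open Connected conn
  open Slide s
  module G = SimpleGraph G
  module H = SimpleGraph H
  r = slide-replaced s
  z∼y : z H.∼ y
  z∼y = Slide.y∼z (slide-sym s)
  reroute : ∀ {u v} → u G.∼ v → Star H._∼_ u v
  reroute {u} {v} u∼v with sameEdge? u v x y
  ... | no  ≢xy                   = return (kept r u∼v ≢xy)
  ... | yes (inj₁ (refl , refl)) = added r ◅ z∼y ◅ ε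
  ... | yes (inj₂ (refl , refl)) = H.sym z∼y ◅ H.sym (added r) ◅ ε

-- Allowing `≈` as a step lets a chain end at a prescribed graph and still be reversed.
Step : Rel (SimpleGraph n) 0ℓ
Step G H = Slide G H ⊎ G ≈ H

infix 4 _⇝_

_⇝_ : Rel (SimpleGraph n) (lsuc 0ℓ)
_⇝_ = Star Step

⇝-sym : Symmetric (_⇝_ {n})
⇝-sym = reverse λ { (inj₁ s) → inj₁ (slide-sym s) ; (inj₂ e) → inj₂ (≈-sym e) }

⇝-edges : G ⇝ H → length (edges G) ≡ length (edges H)
⇝-edges ε = refl
⇝-edges (inj₁ s ◅ r) = trans (replaced-edges (slide-replaced s) x∼y x≁z) (⇝-edges r)
  where open Slide s
⇝-edges (inj₂ e ◅ r) = trans (≈-edges e) (⇝-edges r)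

-- A `≈` step is absorbed into the slide that follows it, so only a final one survives.
⇝⇒slides : G ⇝ H → ∃ λ K → Star Slide G K × K ≈ H
⇝⇒slides ε = _ , ε , ≈-refl
⇝⇒slides (inj₁ s ◅ r) with ⇝⇒slides r
... | K , ss , K≈H = K , s ◅ ss , K≈H
⇝⇒slides (inj₂ e ◅ r) with ⇝⇒slides r
... | _ , ε      , K≈H = _ , ε , ≈-trans e K≈H
... | K , s ◅ ss , K≈H = K , slide-≈ e s ◅ ss , K≈H

-- Graphs with a hub

Hub : SimpleGraph (suc n) → Set
Hub G = ∀ v → v ≢ zero → v ∼ zero
  where open SimpleGraph G

star : ∀ n → SimpleGraph (suc n)
star n = record
  { _∼_    = λ u v → (u ≡ zero × v ≢ zero) ⊎ (v ≡ zero × u ≢ zero)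
  ; _∼?_   = λ u v → ((u ≟ zero) ×-dec ¬? (v ≟ zero)) ⊎-dec ((v ≟ zero) ×-dec ¬? (u ≟ zero))
  ; sym    = swap
  ; irrefl = λ { refl (inj₁ (u≡0 , u≢0)) → u≢0 u≡0 ; refl (inj₂ (u≡0 , u≢0)) → u≢0 u≡0 }
  }

module _ (G : SimpleGraph (suc n)) where
  open SimpleGraph G hiding (sym; edges)

  -- Along a path to `zero`, the last vertex that is neither `zero` nor adjacent to it is followed
  -- by a neighbour of `zero`. These two vertices are the `x` and `y` returned.
  distance-two : ∀ {v} → Star _∼_ v zero →
    v ≡ zero ⊎ v ∼ zero ⊎ ∃₂ λ x y → x ∼ y × y ∼ zero × x ≢ zero × ¬ (x ∼ zero)
  distance-two ε = inj₁ refl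
  distance-two {v} (v∼w ◅ path) with distance-two path
  ... | inj₁ refl            = inj₂ (inj₁ v∼w)
  ... | inj₂ (inj₂ found)    = inj₂ (inj₂ found)
  ... | inj₂ (inj₁ w∼0) with v ≟ zero | v ∼? zero
  ...   | yes v≡0 | _       = inj₁ v≡0
  ...   | no  _   | yes v∼0 = inj₂ (inj₁ v∼0)
  ...   | no  v≢0 | no  v≁0 = inj₂ (inj₂ (v , _ , v∼w , w∼0 , v≢0 , v≁0))

-- Induction on the number `k` of vertices other than `zero` that are not joined to it;
-- connectedness survives each slide and provides the next one.
make-hub : ∀ k (G : SimpleGraph (suc n)) → Connected G → length (missing (star n) G) ≡ k →
           ∃ λ H → G ⇝ H × Hub H
make-hub zero G conn none =
  G , ε , λ v v≢0 → none-missing (star _) G none (inj₂ (refl , v≢0))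
make-hub {n} (suc k) G conn some = continue (far (some-missing (star n) G some))
  where
  open SimpleGraph G using (_∼_)

  Far = ∃₂ λ x y → x ∼ y × y ∼ zero × x ≢ zero × ¬ (x ∼ zero)

  far-from : ∀ {v} → v ≢ zero → ¬ (v ∼ zero) → Far
  far-from v≢0 v≁0 with distance-two G (Connected.path conn _ zero)
  ... | inj₁ v≡0          = contradiction v≡0 v≢0
  ... | inj₂ (inj₁ v∼0)   = contradiction v∼0 v≁0
  ... | inj₂ (inj₂ found) = found

  far : (∃₂ λ u v → SimpleGraph._∼_ (star n) u v × ¬ (u ∼ v)) → Far
  far (_ , _ , inj₁ (refl , v≢0) , u≁v) = far-from v≢0 (u≁v ∘ SimpleGraph.sym G)
  far (_ , _ , inj₂ (refl , u≢0) , u≁v) = far-from u≢0 u≁v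

  continue : Far → ∃ λ H → G ⇝ H × Hub H
  continue (x , y , x∼y , y∼0 , x≢0 , x≁0) =
    let K , G₁⇝K , hub = make-hub k G₁ (slide-connected s conn)
                          (ℕ.suc-injective (trans (sym fewer) some))
    in K , inj₁ s ◅ G₁⇝K , hub
    where
    G₁ = replace G x y x zero x≢0
    s : Slide G G₁
    s = record
      { x≢y = ∼⇒≢ G x∼y ; y≢z = ∼⇒≢ G y∼0 ; x≢z = x≢0
      ; x∼y = x∼y ; y∼z = y∼0 ; x≁z = x≁0
      ; result = replace-replaced {G = G} x≢0 .rule }
    fewer : length (missing (star n) G) ≡ suc (length (missing (star n) G₁))
    -- Neither `x` nor `y` is `zero`, so the edge `xy` given up is not an edge of the star.
    fewer = replaced-missing (slide-replaced s) (star n)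
      (λ { (inj₁ (x≡0 , _)) → x≢0 x≡0 ; (inj₂ (y≡0 , _)) → ∼⇒≢ G y∼0 y≡0 })
      (inj₂ (refl , x≢0)) x≁0

-- Moving edges in a graph with a hub

hub-nonzero : Hub G → let open SimpleGraph G in u ≢ v → ¬ (u ∼ v) → u ≢ zero × v ≢ zero
hub-nonzero {G = G} hub u≢v u≁v =
  (λ { refl → u≁v (SimpleGraph.sym G (hub _ (≢-sym u≢v))) }) ,
  (λ { refl → u≁v (hub _ u≢v) })

hub-kept : Replaced G H a b c d → a ≢ zero → b ≢ zero → Hub G → Hub H
hub-kept r a≢0 b≢0 hub v v≢0 = kept r (hub v v≢0) λ
  { (inj₁ (_ , 0≡b)) → b≢0 (sym 0≡b) ; (inj₂ (_ , 0≡a)) → a≢0 (sym 0≡a) }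

-- A direct slide would require `y ∼ z`. Instead the spoke from `x` to `zero` is slid to `xz`, and
-- `xy` then slides into the place of the spoke, so the hub is restored.
pivot : ∀ {n} {G H : SimpleGraph (suc n)} {x y z} → let open SimpleGraph G in
        Hub G → x ≢ zero → y ≢ zero → z ≢ zero → x ≢ z →
        x ∼ y → ¬ (x ∼ z) → Replaced G H x y x z → G ⇝ H
pivot {G = G} {H} {x} {y} {z} hub x≢0 y≢0 z≢0 x≢z x∼y x≁z r = inj₁ s₁ ◅ inj₁ s₂ ◅ ε
  where
  y≢z : y ≢ z
  y≢z refl = x≁z x∼y
  x≢y = ∼⇒≢ G x∼y
  r₁ = replace-replaced {G = G} {a = x} {b = zero} x≢z
  s₁ : Slide G (replace G x zero x z x≢z)
  s₁ = record
    { x≢y = x≢0 ; y≢z = ≢-sym z≢0 ; x≢z = x≢z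
    ; x∼y = hub x x≢0 ; y∼z = SimpleGraph.sym G (hub z z≢0) ; x≁z = x≁z
    ; result = r₁ .rule }
  s₂ : Slide (replace G x zero x z x≢z) H
  s₂ = record
    { x≢y = x≢y ; y≢z = y≢0 ; x≢z = x≢0
    ; x∼y = kept r₁ x∼y λ { (inj₁ (_ , y≡0)) → y≢0 y≡0 ; (inj₂ (x≡0 , _)) → x≢0 x≡0 }
    ; y∼z = kept r₁ (hub y y≢0) λ { (inj₁ (y≡x , _)) → x≢y (sym y≡x) ; (inj₂ (y≡0 , _)) → y≢0 y≡0 }
    ; x≁z = removed r₁ λ { (inj₁ (_ , 0≡z)) → z≢0 (sym 0≡z) ; (inj₂ (x≡z , _)) → x≢z x≡z }
    -- The replacement of `xy` by `xz` factors through the first slide, which leaves exactly the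
    -- replacement of `xy` by the spoke.
    ; result = replaced-exchange r₁ r (hub x x≢0)
        (λ { (inj₁ (_ , 0≡y)) → y≢0 (sym 0≡y) ; (inj₂ (x≡y , _)) → x≢y x≡y })
        (λ { (inj₁ (_ , z≡y)) → y≢z (sym z≡y) ; (inj₂ (x≡y , _)) → x≢y x≡y }) .rule }

-- If the two pairs share a vertex, one pivot suffices. Otherwise the pair `ac` serves as an
-- intermediate place: if it is free, `ab` moves to `ac` and on to `cd`; if it is occupied, `ac`
-- first moves to `cd` and `ab` then takes its place.
relocate : ∀ {n} {G H : SimpleGraph (suc n)} {a b c d} → let open SimpleGraph G in
           Hub G → a ≢ zero → b ≢ zero → c ≢ zero → d ≢ zero → c ≢ d →
           a ∼ b → ¬ (c ∼ d) → Replaced G H a b c d → G ⇝ H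
relocate {G = G} {H} {a} {b} {c} {d} hub a≢0 b≢0 c≢0 d≢0 c≢d a∼b c≁d r
  with a ≟ c | a ≟ d | b ≟ c | b ≟ d
... | yes refl | _ | _ | _ = pivot hub a≢0 b≢0 d≢0 c≢d a∼b c≁d r
... | _ | yes refl | _ | _ =
  pivot hub a≢0 b≢0 c≢0 (≢-sym c≢d) a∼b (c≁d ∘ G.sym) (replaced-swapʳ r)
  where module G = SimpleGraph G
... | _ | _ | yes refl | _ = pivot hub b≢0 a≢0 d≢0 c≢d (G.sym a∼b) c≁d (replaced-swapˡ r)
  where module G = SimpleGraph G
... | _ | _ | _ | yes refl =
  pivot hub b≢0 a≢0 c≢0 (≢-sym c≢d) (G.sym a∼b) (c≁d ∘ G.sym) (replaced-swapʳ (replaced-swapˡ r))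
  where module G = SimpleGraph G
... | no a≢c | no a≢d | no b≢c | no b≢d with SimpleGraph._∼?_ G a c
... | yes a∼c =
  pivot {x = c} {a} {d} hub c≢0 a≢0 d≢0 c≢d (G.sym a∼c) c≁d r₁ ◅◅
  pivot {x = a} {b} {c} (hub-kept r₁ c≢0 a≢0 hub) a≢0 b≢0 c≢0 a≢c
    (kept r₁ a∼b λ { (inj₁ (a≡c , _)) → a≢c a≡c ; (inj₂ (_ , b≡c)) → b≢c b≡c })
    (removed r₁ (λ { (inj₁ (_ , a≡d)) → a≢d a≡d ; (inj₂ (c≡d , _)) → c≢d c≡d }) ∘ SimpleGraph.sym G₁)
    (replaced-swapʳ (replaced-exchange r₁ r (G.sym a∼c)
      (λ { (inj₁ (c≡a , _)) → a≢c (sym c≡a) ; (inj₂ (c≡b , _)) → b≢c (sym c≡b) })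
      (λ { (inj₁ (c≡a , _)) → a≢c (sym c≡a) ; (inj₂ (c≡b , _)) → b≢c (sym c≡b) })))
  where
  module G = SimpleGraph G
  G₁ = replace G c a c d c≢d
  r₁ = replace-replaced {G = G} {a = c} {b = a} c≢d
... | no a≁c =
  pivot {x = a} {b} {c} hub a≢0 b≢0 c≢0 a≢c a∼b a≁c r₁ ◅◅
  pivot {x = c} {a} {d} (hub-kept r₁ a≢0 b≢0 hub) c≢0 a≢0 d≢0 c≢d
    (SimpleGraph.sym G₁ (added r₁))
    (λ c∼d → c≁d (origin r₁ c∼d
      λ { (inj₁ (c≡a , _)) → a≢c (sym c≡a) ; (inj₂ (_ , d≡a)) → a≢d (sym d≡a) }))
    (replaced-swapˡ (replaced-compose r₁ r a≁c))
  where
  G₁ = replace G a b a c a≢c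
  r₁ = replace-replaced {G = G} {a = a} {b = b} a≢c

hubs-connect : ∀ k (G T : SimpleGraph (suc n)) → Hub G → Hub T →
               length (edges G) ≡ length (edges T) → length (missing T G) ≡ k → G ⇝ T
hubs-connect zero G T hubG hubT eq none = return (inj₂ (mk≈ λ u v → mk⇔
  -- An edge of `G` outside `T` would, the edge counts being equal, force an edge of `T` outside
  -- `G`, but none is missing.
  (λ u∼v → decidable-stable (SimpleGraph._∼?_ T u v) λ u≁v →
    let _ , _ , p∼q , p≁q = surplus-∃ {T = G} {T} eq u∼v u≁v
    in p≁q (none-missing T G none p∼q))
  (none-missing T G none)))
hubs-connect (suc k) G T hubG hubT eq some
  with some-missing T G some
... | c , d , c∼d , c≁d with surplus-∃ {T = T} {G} (sym eq) c∼d c≁d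
... | a , b , a∼b , a≁b =
  G⇝G₁ ◅◅
  hubs-connect k G₁ T (hub-kept r a≢0 b≢0 hubG) hubT
    (trans (sym (⇝-edges G⇝G₁)) eq)
    (ℕ.suc-injective (trans (sym (replaced-missing r T a≁b c∼d c≁d)) some))
  where
  c≢d = ∼⇒≢ T c∼d
  G₁ = replace G a b c d c≢d
  r = replace-replaced {G = G} {a = a} {b = b} c≢d
  -- The pair `ab` is a non-edge of `T` and `cd` a non-edge of `G`. As `zero` is a hub of both
  -- graphs, neither pair contains it, and the replacement leaves all spokes intact.
  ab≢0 = hub-nonzero {G = T} hubT (∼⇒≢ G a∼b) a≁b
  cd≢0 = hub-nonzero {G = G} hubG c≢d c≁d
  a≢0 = proj₁ ab≢0
  b≢0 = proj₂ ab≢0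
  G⇝G₁ : G ⇝ G₁
  G⇝G₁ = relocate hubG a≢0 b≢0 (proj₁ cd≢0) (proj₂ cd≢0) c≢d a∼b c≁d r

-- Both graphs are first given a hub; the chain for `T` is then run backwards. Slides preserve the
-- number of edges, so the two hub graphs still have equally many.
connected-⇝ : (G T : SimpleGraph n) → Connected G → Connected T →
              length (edges G) ≡ length (edges T) → G ⇝ T
connected-⇝ {zero} G T conn _ _ = contradiction (Connected.nonEmpty conn) λ ()
connected-⇝ {suc n} G T connG connT eq
  with make-hub _ G connG refl | make-hub _ T connT refl
... | G′ , G⇝G′ , hubG′ | T′ , T⇝T′ , hubT′ =
  G⇝G′ ◅◅
  hubs-connect _ G′ T′ hubG′ hubT′
    (trans (sym (⇝-edges G⇝G′)) (trans eq (⇝-edges T⇝T′))) refl ◅◅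
  ⇝-sym T⇝T′

-- Attaching leaves

-- The leaf is `zero` and the old vertices are shifted by `suc`, which is `punchIn zero`; the
-- conditions of `AddLeaf` then hold by definition.
attach : SimpleGraph n → Fin n → SimpleGraph (suc n)
attach {n} G x = record
  { _∼_ = _∼⁺_ ; _∼?_ = dec ; sym = λ {u} {v} → symm u v ; irrefl = λ { {u} refl → irr u } }
  where
  open SimpleGraph G
  _∼⁺_ : Rel (Fin (suc n)) 0ℓ
  zero  ∼⁺ zero  = ⊥
  zero  ∼⁺ suc v = v ≡ x
  suc u ∼⁺ zero  = u ≡ x
  suc u ∼⁺ suc v = u ∼ v
  dec : ∀ u v → Dec (u ∼⁺ v)
  dec zero    zero    = no λ ()
  dec zero    (suc v) = v ≟ x
  dec (suc u) zero    = u ≟ x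
  dec (suc u) (suc v) = u ∼? v
  symm : ∀ u v → u ∼⁺ v → v ∼⁺ u
  symm zero    (suc v) = id
  symm (suc u) zero    = id
  symm (suc u) (suc v) = SimpleGraph.sym G
  irr : ∀ u → ¬ (u ∼⁺ u)
  irr (suc u) = irrefl refl

attach-leaf : (G : SimpleGraph n) (x : Fin n) → AddLeaf G (attach G x)
attach-leaf G x = record
  { x = x ; y = zero ; old = λ _ _ → ⇔-id _ ; new = λ _ → ⇔-id _ }

attach-connected : Connected G → (x : Fin n) → Connected (attach {n} G x)
attach-connected {n} {G} conn x = record { nonEmpty = _ ; path = path⁺ }
  where
  open Connected conn
  module G⁺ = SimpleGraph (attach G x)
  lift : ∀ u v → Star G⁺._∼_ (suc u) (suc v)
  lift u v = gmap suc id (path u v)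
  path⁺ : ∀ u v → Star G⁺._∼_ u v
  path⁺ zero    zero    = ε
  path⁺ zero    (suc v) = _◅_ {j = suc x} refl (lift x v)
  path⁺ (suc u) zero    = lift u x ◅◅ return refl
  path⁺ (suc u) (suc v) = lift u v

attach-edges : (G : SimpleGraph n) (x : Fin n) →
               length (edges (attach G x)) ≡ suc (length (edges G))
attach-edges {n} G x = trans
  -- The leaf is the least vertex, so its edge is listed with `zero` first, and shifting by `suc`
  -- keeps the order of the other pairs.
  (unique-length {ys = (zero , suc x) ∷ map sucs (edges G)} (edges-unique G⁺)
    (∉⇒unique-∷ (λ i → case ∈-map⁻ sucs i of λ { (_ , _ , ()) })
      (Unique.map⁺ (λ { refl → refl }) (edges-unique G)))
    (mk⇔ forth back))
  (cong suc (length-map sucs (edges G)))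
  where
  G⁺ = attach G x
  sucs : Fin n × Fin n → Fin (suc n) × Fin (suc n)
  sucs = Product.map suc suc
  forth : ∀ {e} → e ∈ edges G⁺ → e ∈ (zero , suc x) ∷ map sucs (edges G)
  forth {u , v} i with ∈-edges⁻ G⁺ i
  forth {zero  , suc v} i | _       , refl = here refl
  forth {suc u , suc v} i | s<s u<v , u∼v  = there (∈-map⁺ sucs (∈-edges⁺ G u<v u∼v))
  back : ∀ {e} → e ∈ (zero , suc x) ∷ map sucs (edges G) → e ∈ edges G⁺
  back (here refl) = ∈-edges⁺ G⁺ z<s refl
  back (there i) with ∈-map⁻ sucs i
  ... | e , e∈ , refl = let u<v , u∼v = ∈-edges⁻ G e∈ in ∈-edges⁺ G⁺ (s<s u<v) u∼v

attach-χ : (G : SimpleGraph n) (x : Fin n) → χ (attach G x) ≡ χ G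
attach-χ {n} G x = begin
  ℤ.+ suc n ℤ.- ℤ.+ length (edges (attach G x)) ≡⟨ cong (λ k → ℤ.+ suc n ℤ.- ℤ.+ k) (attach-edges G x) ⟩
  ℤ.+ suc n ℤ.- ℤ.+ suc e                       ≡⟨ ℤ.m-n≡m⊖n (suc n) (suc e) ⟩
  suc n ℤ.⊖ suc e                               ≡⟨ ℤ.[1+m]⊖[1+n]≡m⊖n n e ⟩
  n ℤ.⊖ e                                       ≡⟨ ℤ.m-n≡m⊖n n e ⟨
  ℤ.+ n ℤ.- ℤ.+ e                               ∎
  where
  open ≡-Reasoning
  e = length (edges G)

single-neighbour : (G : SimpleGraph n) → let open SimpleGraph G in
                   (∀ {u} → v ∼ u ⇔ u ≡ p) → degree v ≡ 1
single-neighbour {n} {v} {p} G only = unique-length {ys = p ∷ []}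
  (Unique.filter⁺ (v ∼?_) (Unique.allFin⁺ n)) ([] ∷ [])
  (mk⇔ (λ i → here (only .to (proj₂ (∈-filter⁻ (v ∼?_) {xs = allFin n} i))))
       (λ { (here refl) → ∈-filter⁺ (v ∼?_) (∈-allFin _) (only .from refl) }))
  where open SimpleGraph G

-- Formulated for every `K` with the adjacency of `attach G x`, because the slides that start from
-- the larger graph reach the grown graph only up to `≈`.
detach-leaf : (G : SimpleGraph n) (x : Fin n) → attach G x ≈ K → DeleteLeaf K G
detach-leaf {K = K} G x e = record
  { y = zero
  ; deg-y = single-neighbour {p = suc x} K only
  ; result = λ u v → e .adj (suc u) (suc v)
  }
  where
  only : ∀ {u} → SimpleGraph._∼_ K zero u ⇔ u ≡ suc x
  only {zero}  = mk⇔ (λ 0∼0 → contradiction refl (∼⇒≢ K 0∼0)) λ ()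
  only {suc u} = mk⇔ (λ k → cong suc (e .adj zero (suc u) .from k))
                     (λ { refl → e .adj zero (suc u) .to refl })

-- One growth serves both halves of the theorem: `expand` leads up to `graph`, and `collapse` leads
-- back down from any graph with the same adjacency. The field `χ-kept` is what later yields equal
-- edge counts.
record Grown {m} (G : SimpleGraph m) (n : ℕ) : Set₁ where
  field
    graph     : SimpleGraph n
    connected : Connected graph
    χ-kept    : χ graph ≡ χ G
    expand    : Star ExpandOrSlide (m , G) (n , graph)
    collapse  : ∀ {K} → graph ≈ K → TransformsInto CollapseOrSlide K G

grow : ∀ {m n} → m ≤′ n → (G : SimpleGraph m) → Connected G → Grown G n
grow ≤′-refl G conn = record
  { graph = G ; connected = conn ; χ-kept = refl ; expand = ε
  ; collapse = λ e → _ , ε , ≈⇒≅ (≈-sym e) }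
grow (≤′-step m≤n) G conn = record
  { graph     = attach graph x
  ; connected = attach-connected connected x
  ; χ-kept    = trans (attach-χ graph x) χ-kept
  ; expand    = expand ◅◅ return (addLeaf (attach-leaf graph x))
  -- Deleting the leaf lands on the smaller `graph` itself, so the discrepancy `e` is used up by
  -- this one move.
  ; collapse  = λ e → let K , moves , K≅G = collapse ≈-refl
                      in K , deleteLeaf (detach-leaf graph x e) ◅ moves , K≅G
  }
  where
  open Grown (grow m≤n G conn)
  -- A leaf may be attached anywhere; a connected graph has a vertex, and the first is taken.
  vertex : ∀ {n} → NonZero n → Fin n
  vertex {suc _} _ = zero
  x = vertex (Connected.nonEmpty connected)

χ⇒edges : (G H : SimpleGraph n) → χ G ≡ χ H → length (edges G) ≡ length (edges H)
χ⇒edges {n} G H eq = ℤ.+-injective (ℤ.neg-injective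
  (∙-cancelˡ (AbelianGroup.group ℤ.+-0-abelianGroup) (ℤ.+ n) _ _ eq))

corollary5p1 : ∀ {m n : ℕ} (Γ : SimpleGraph m) (Σ : SimpleGraph n) →
    Connected Γ → Connected Σ →
    SimpleGraph.χ Γ ≡ SimpleGraph.χ Σ → m ≤ n →
    TransformsInto ExpandOrSlide Γ Σ × TransformsInto CollapseOrSlide Σ Γ
corollary5p1 {n = n} Γ Σ connΓ connΣ χ-eq m≤n = expanding , collapsing
  where
  open Grown (grow (ℕ.≤⇒≤′ m≤n) Γ connΓ)
  graph⇝Σ : graph ⇝ Σ
  graph⇝Σ = connected-⇝ graph Σ connected connΣ (χ⇒edges graph Σ (trans χ-kept χ-eq))
  expanding : TransformsInto ExpandOrSlide Γ Σ
  expanding =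
    let K , slides , K≈Σ = ⇝⇒slides graph⇝Σ
    in (n , K) , expand ◅◅ gmap (n ,_) slide slides , ≈⇒≅ K≈Σ
  collapsing : TransformsInto CollapseOrSlide Σ Γ
  collapsing =
    -- The same chain of slides is run backwards from `Σ`, after which the attached leaves are
    -- removed one by one.
    let K , slides , K≈graph = ⇝⇒slides (⇝-sym graph⇝Σ)
        L , moves , L≅Γ = collapse (≈-sym K≈graph)
    in L , gmap (n ,_) slide slides ◅◅ moves , L≅Γ
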